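{- $r'_2(5)=10$.
   Context: All graphs are finite and simple. A threshold graph of order $s$ is an $s$-vertex graph that can be constructed from the one-vertex graph by repeatedly adding a new vertex that is either adjacent to all the previous vertices or nonadjacent to all the previous vertices. For a positive integer $s$, $r'_2(s)$ is the minimum integer $n$ such that every $n$-vertex graph contains a threshold graph of order $s$ as an induced subgraph. -}

module Defs where

open import Data.Bool using (Bool; true; false)
open import Data.Fin using (Fin; zero; suc)
open import Data.Nat using (ℕ; suc; _≤_)
open import Data.Product using (Σ-syntax; ∃-syntax; _×_)
open import Function.Bundles using (_↣_; _↔_; Injection; Inverse)
open import Relation.Binary.PropositionalEquality using (_≡_; refl)

-- A finite simple graph on the vertex set Fin n, given by its adjacency
-- matrix (so adjacency is decidable, as it is classically for any graph).
record Graph (n : ℕ) : Set where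
  field
    adj    : Fin n → Fin n → Bool
    sym    : ∀ u v → adj u v ≡ adj v u
    irrefl : ∀ v → adj v v ≡ false

open Graph public

infix 4 _≅_ _⊑_

_≅_ : ∀ {m n} → Graph m → Graph n → Set
_≅_ {m} {n} G H =
  Σ[ f ∈ Fin m ↔ Fin n ] (∀ u v → adj H (Inverse.to f u) (Inverse.to f v) ≡ adj G u v)

-- G ⊑ H: some induced subgraph of H is isomorphic to G.
_⊑_ : ∀ {m n} → Graph m → Graph n → Set
_⊑_ {m} {n} G H =
  Σ[ f ∈ Fin m ↣ Fin n ] (∀ u v → adj H (Injection.to f u) (Injection.to f v) ≡ adj G u v)

K₁ : Graph 1
K₁ .adj _ _ = false
K₁ .sym _ _ = refl
K₁ .irrefl _ = refl

-- The new vertex is zero; it is adjacent to every previous vertex if b is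
-- true, and to none if b is false.
addVertex : ∀ {n} → Bool → Graph n → Graph (suc n)
addVertex b G .adj zero    zero    = false
addVertex b G .adj zero    (suc v) = b
addVertex b G .adj (suc u) zero    = b
addVertex b G .adj (suc u) (suc v) = adj G u v
addVertex b G .sym zero    zero    = refl
addVertex b G .sym zero    (suc v) = refl
addVertex b G .sym (suc u) zero    = refl
addVertex b G .sym (suc u) (suc v) = sym G u v
addVertex b G .irrefl zero    = refl
addVertex b G .irrefl (suc v) = irrefl G v

data Constructed : ∀ {n} → Graph n → Set where
  start : Constructed K₁
  add   : ∀ {n} {G : Graph n} (b : Bool) → Constructed G → Constructed (addVertex b G)

-- Constructed fixes the vertex labels, so close it under isomorphism.
Threshold : ∀ {n} → Graph n → Set
Threshold {n} G = ∃[ T ] (Constructed {n} T × T ≅ G)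

ContainsThreshold : ℕ → ∀ {n} → Graph n → Set
ContainsThreshold s G = Σ[ T ∈ Graph s ] (Threshold T × T ⊑ G)

IsMinimum : (ℕ → Set) → ℕ → Set
IsMinimum P n = P n × (∀ m → P m → n ≤ m)

-- The equation r′₂(s) = n as a relation, since existence of the minimum for
-- every s is itself a theorem.
r′₂[_]≡_ : ℕ → ℕ → Set
r′₂[ s ]≡ n = IsMinimum (λ k → ∀ (G : Graph k) → ContainsThreshold s G) n

{-# OPTIONS --safe #-}

-- Upper bound.  Let x be a vertex, N its neighbours and M its non-neighbours;
-- passing to the complement if necessary, |N| ≥ 5.  Any three vertices induce
-- a threshold graph, hence so do x, y and three further vertices whenever
-- x treats y and the three alike and y treats the three alike.  If |N| ≥ 6,
-- some y ∈ N and three vertices of N that y treats alike will do.  Otherwise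
-- |N| = 5 and |M| = 4.  If some a ∈ N has three neighbours in M, then a, x and
-- these three will do; if some m ∈ M has three non-neighbours in N, then m, x
-- and those three will do.  If neither happens there are at most 2·5 + 2·4
-- pairs in N × M, but 5·4 > 18.
--
-- Lower bound.  In the 3 × 3 rook's graph every vertex has four neighbours,
-- inducing 2K₂, and four non-neighbours, inducing C₄; neither is threshold.
module Submission where

open import Defs

open import Data.Bool using (Bool; true; false; not; _xor_)
open import Data.Bool.Properties using (_≟_; not-¬)
open import Data.Fin using (Fin; zero; suc; inject≤; quotient; remainder)
open import Data.Fin.Properties as Fin using (all?; inject≤-injective; suc-injective; 0≢1+n)
open import Data.Fin.Patterns using (0F; 1F; 2F; 3F; 4F)
open import Data.List using (List; []; _∷_; filter; length; map; tabulate)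
open import Data.List.Membership.Propositional using (_∈_; find)
open import Data.List.Relation.Binary.Subset.Propositional using (_⊆_)
open import Data.List.Relation.Unary.All as All using (All; []; _∷_)
import Data.List.Relation.Unary.All.Properties as All
open import Data.List.Relation.Unary.Any using (Any; here; there)
open import Data.List.Relation.Unary.AllPairs using ([]; _∷_)
open import Data.List.Relation.Unary.Unique.Propositional using (Unique)
import Data.List.Relation.Unary.Unique.Propositional.Properties as Unique
open import Data.Nat using (ℕ; suc; _+_; _*_; _≤_; _<_; s≤s; s≤s⁻¹; _≤?_; _<?_)
open import Data.Nat.ListAction using (sum)
open import Data.Nat.Properties as ℕ
  using (+-suc; +-mono-≤; +-cancelˡ-≡; ≮⇒≥; ≰⇒>; <⇒≱; ≤-antisym)
open import Algebra.Properties.CommutativeSemigroup ℕ.+-commutativeSemigroup using (interchange; x∙yz≈y∙xz)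
open import Data.Product using (Σ-syntax; ∃-syntax; _×_; _,_; proj₁; proj₂)
open import Data.Sum using (_⊎_; inj₁; inj₂)
open import Function using (_∘_; flip)
open import Function.Bundles using (_↣_; Injection; mk↣)
open import Function.Construct.Identity using (↔-id)
open import Function.Properties.Injection using (↣-trans)
open import Function.Properties.Inverse using (↔⇒↣)
open import Relation.Binary.PropositionalEquality
  using (_≡_; _≢_; refl; trans; cong; cong₂; subst; ≢-sym; module ≡-Reasoning)
  renaming (sym to ≡-sym)
open import Relation.Nullary using (¬_; yes; no; ¬?; contradiction)
open import Relation.Nullary.Decidable using (Dec; does; _×-dec_; _→-dec_; toWitness)

private
  variable
    A B : Set
    m n s : ℕ
    b c : Bool

-- Double counting

matching : (A → Bool) → Bool → List A → List A
matching f b = filter (λ x → f x ≟ b)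

length-matching : ∀ (f : A → Bool) b xs →
  length (matching f b xs) + length (matching f (not b) xs) ≡ length xs
length-matching f b [] = refl
length-matching f b (x ∷ xs) with ih ← length-matching f b xs | f x | b
... | true  | true  = cong suc ih
... | true  | false = trans (+-suc _ _) (cong suc ih)
... | false | true  = trans (+-suc _ _) (cong suc ih)
... | false | false = cong suc ih

-- Otherwise both classes would have at most `k` elements, and the whole list at most `k + k`.
majority : ∀ k (f : A → Bool) xs → k + k < length xs →
  ∃[ b ] k < length (matching f b xs)
majority k f xs 2k< with k <? length (matching f true xs) | k <? length (matching f false xs)
... | yes k< | _      = true , k<
... | no  _  | yes k< = false , k<
... | no  k≮ | no  k≮′ =
  contradiction (+-mono-≤ (≮⇒≥ k≮) (≮⇒≥ k≮′))
    (<⇒≱ (subst (k + k <_) (≡-sym (length-matching f true xs)) 2k<))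

shift : ∀ i j {k l} → k ≡ j + l → i + k ≡ j + (i + l)
shift i j {l = l} refl = x∙yz≈y∙xz i j l

-- Peels the row of `x` off the column counts, for the induction on `xs` in `double-count`.
sum-matching-∷ : ∀ (R : A → B → Bool) b x xs ys →
  sum (map (λ y → length (matching (flip R y) b (x ∷ xs))) ys) ≡
  length (matching (R x) b ys) + sum (map (λ y → length (matching (flip R y) b xs)) ys)
sum-matching-∷ R b x xs [] = refl
sum-matching-∷ R b x xs (y ∷ ys) with ih ← sum-matching-∷ R b x xs ys | R x y ≟ b
... | yes _ = cong suc (shift (length (matching (flip R y) b xs)) (length (matching (R x) b ys)) ih)
... | no  _ = shift (length (matching (flip R y) b xs)) (length (matching (R x) b ys)) ih

-- Each pair is counted exactly once: in its row if `R x y` is `b`, in its column otherwise.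
double-count : ∀ (R : A → B → Bool) b xs ys →
  sum (map (λ x → length (matching (R x) b ys)) xs) +
  sum (map (λ y → length (matching (flip R y) (not b) xs)) ys) ≡
  length xs * length ys
double-count R b [] ys = sum-zero ys
  where
  sum-zero : ∀ (ys : List A) → sum (map (λ _ → 0) ys) ≡ 0
  sum-zero []       = refl
  sum-zero (_ ∷ ys) = sum-zero ys
double-count R b (x ∷ xs) ys = begin
  (length (matching (R x) b ys) + rows) + sum (map (λ y → length (matching (flip R y) (not b) (x ∷ xs))) ys)
    ≡⟨ cong (λ t → (length (matching (R x) b ys) + rows) + t) (sum-matching-∷ R (not b) x xs ys) ⟩
  (length (matching (R x) b ys) + rows) + (length (matching (R x) (not b) ys) + columns)
    ≡⟨ interchange (length (matching (R x) b ys)) _ _ _ ⟩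
  (length (matching (R x) b ys) + length (matching (R x) (not b) ys)) + (rows + columns)
    ≡⟨ cong₂ _+_ (length-matching (R x) b ys) (double-count R b xs ys) ⟩
  length ys + length xs * length ys ∎
  where
  open ≡-Reasoning
  rows columns : ℕ
  rows    = sum (map (λ x → length (matching (R x) b ys)) xs)
  columns = sum (map (λ y → length (matching (flip R y) (not b) xs)) ys)

pigeonhole : ∀ k (f : A → ℕ) xs → length xs * k < sum (map f xs) → Any (λ x → k < f x) xs
pigeonhole k f (x ∷ xs) lt with k <? f x
... | yes k<fx = here k<fx
-- The head contributes at most `k`, so the tail still exceeds its share.
... | no  k≮fx = there (pigeonhole k f xs (≰⇒> λ ge → <⇒≱ lt (+-mono-≤ (≮⇒≥ k≮fx) ge)))

-- One of the two sums in `double-count` must exceed its share of the bound, and `pigeonhole` then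
-- locates the row or column.
heavy-row-or-column : ∀ k l (R : A → B → Bool) b xs ys →
  length xs * k + length ys * l < length xs * length ys →
  Any (λ x → k < length (matching (R x) b ys)) xs ⊎
  Any (λ y → l < length (matching (flip R y) (not b) xs)) ys
heavy-row-or-column k l R b xs ys lt
  with length xs * k <? sum (map (λ x → length (matching (R x) b ys)) xs)
     | length ys * l <? sum (map (λ y → length (matching (flip R y) (not b) xs)) ys)
... | yes lt′ | _       = inj₁ (pigeonhole k _ xs lt′)
... | no  _   | yes lt′ = inj₂ (pigeonhole l _ ys lt′)
... | no  ≮₁  | no  ≮₂  =
  contradiction (+-mono-≤ (≮⇒≥ ≮₁) (≮⇒≥ ≮₂))
    (<⇒≱ (subst (length xs * k + length ys * l <_) (≡-sym (double-count R b xs ys)) lt))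

-- Embedded threshold graphs

⊑-trans : ∀ {k} (F : Graph k) (G : Graph m) (H : Graph n) → F ⊑ G → G ⊑ H → F ⊑ H
⊑-trans _ _ _ (f , f-adj) (g , g-adj) =
  ↣-trans f g , λ u v → trans (g-adj (Injection.to f u) (Injection.to f v)) (f-adj u v)

≅⇒⊑ : (G : Graph m) (H : Graph n) → G ≅ H → G ⊑ H
≅⇒⊑ _ _ (f , f-adj) = ↔⇒↣ f , f-adj

induced : (Fin m → Fin n) → Graph n → Graph m
induced f G .adj u v  = adj G (f u) (f v)
induced f G .sym u v  = sym G (f u) (f v)
induced f G .irrefl v = irrefl G (f v)

induced-⊑ : (f : Fin m ↣ Fin n) (G : Graph n) → induced (Injection.to f) G ⊑ G
induced-⊑ f G = f , λ _ _ → refl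

module _ (G : Graph n) where

  -- The list bounds where the embedding lands, so that a new vertex can be checked against a list
  -- of vertices. Asking for `Constructed` keeps `addVertex` directly applicable.
  ThresholdIn : ℕ → List (Fin n) → Set
  ThresholdIn s xs = Σ[ T ∈ Graph s ] Constructed T ×
    (Σ[ (f , _) ∈ T ⊑ G ] (∀ u → Injection.to f u ∈ xs))

  -- Distinctness is explicit because for `b = false` the equation also holds when `x` and `y`
  -- coincide.
  Joined : Bool → Fin n → Fin n → Set
  Joined b x y = x ≢ y × adj G x y ≡ b

  ThresholdIn⇒ContainsThreshold : ∀ {xs} → ThresholdIn s xs → ContainsThreshold s G
  ThresholdIn⇒ContainsThreshold (T , T-constructed , T⊑G , _) =
    T , (T , T-constructed , ↔-id _ , λ _ _ → refl) , T⊑G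

  ThresholdIn-⊆ : ∀ {xs ys} → xs ⊆ ys → ThresholdIn s xs → ThresholdIn s ys
  ThresholdIn-⊆ xs⊆ys (T , T-constructed , T⊑G , ∈xs) = T , T-constructed , T⊑G , xs⊆ys ∘ ∈xs

  Joined-sym : ∀ {x y} → Joined b x y → Joined b y x
  Joined-sym {x = x} {y} (x≢y , xy) = ≢-sym x≢y , trans (sym G y x) xy

  singleton : ∀ x → ThresholdIn 1 (x ∷ [])
  singleton x = K₁ , start , (mk↣ {to = λ _ → x} (λ {u} {v} _ → unique u v) , λ _ _ → irrefl G x) , λ _ → here refl
    where
    unique : (u v : Fin 1) → u ≡ v
    unique zero zero = refl

  extend : ∀ {x zs} → All (Joined b x) zs → ThresholdIn s zs → ThresholdIn (suc s) (x ∷ zs)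
  extend {b = b} {s = s} {x = x} {zs} joined (T , T-constructed , (f , f-adj) , ∈zs) =
    addVertex b T , add b T-constructed , (mk↣ to-injective , to-adj) , to-∈
    where
    to : Fin (suc s) → Fin n
    to zero    = x
    to (suc u) = Injection.to f u

    join : ∀ u → Joined b x (Injection.to f u)
    join u = All.lookup joined (∈zs u)

    to-injective : ∀ {u v} → to u ≡ to v → u ≡ v
    to-injective {zero}  {zero}  _  = refl
    to-injective {zero}  {suc v} eq = contradiction eq (proj₁ (join v))
    to-injective {suc u} {zero}  eq = contradiction (≡-sym eq) (proj₁ (join u))
    to-injective {suc u} {suc v} eq = cong suc (Injection.injective f eq)

    to-adj : ∀ u v → adj G (to u) (to v) ≡ adj (addVertex b T) u v
    to-adj zero    zero    = irrefl G x
    to-adj zero    (suc v) = proj₂ (join v)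
    to-adj (suc u) zero    = proj₂ (Joined-sym (join u))
    to-adj (suc u) (suc v) = f-adj u v

    to-∈ : ∀ u → to u ∈ x ∷ zs
    to-∈ zero    = here refl
    to-∈ (suc u) = there (∈zs u)

  pair : ∀ {x y} → x ≢ y → ThresholdIn 2 (x ∷ y ∷ [])
  pair {y = y} x≢y = extend ((x≢y , refl) ∷ []) (singleton y)

  -- Two of the three adjacencies agree, so the vertex they share goes last.
  triple : ∀ {xs} → Unique xs → 3 ≤ length xs → ThresholdIn 3 xs
  triple {x ∷ y ∷ z ∷ xs} ((x≢y ∷ x≢z ∷ _) ∷ (y≢z ∷ _) ∷ _) (s≤s (s≤s (s≤s _))) =
    pick (adj G x y) (adj G x z) (adj G y z) refl refl refl
    where
    apex-x : Joined b x y → Joined b x z → ThresholdIn 3 (x ∷ y ∷ z ∷ xs)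
    apex-x xy xz = ThresholdIn-⊆
      (λ { (here p) → here p ; (there (here p)) → there (here p)
         ; (there (there (here p))) → there (there (here p)) })
      (extend (xy ∷ xz ∷ []) (pair y≢z))

    apex-y : Joined b x y → Joined b y z → ThresholdIn 3 (x ∷ y ∷ z ∷ xs)
    apex-y xy yz = ThresholdIn-⊆
      (λ { (here p) → there (here p) ; (there (here p)) → here p
         ; (there (there (here p))) → there (there (here p)) })
      (extend (Joined-sym xy ∷ yz ∷ []) (pair x≢z))

    apex-z : Joined b x z → Joined b y z → ThresholdIn 3 (x ∷ y ∷ z ∷ xs)
    apex-z xz yz = ThresholdIn-⊆
      (λ { (here p) → there (there (here p)) ; (there (here p)) → here p
         ; (there (there (here p))) → there (here p) })
      (extend (Joined-sym xz ∷ Joined-sym yz ∷ []) (pair x≢y))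

    pick : ∀ b c d → adj G x y ≡ b → adj G x z ≡ c → adj G y z ≡ d →
           ThresholdIn 3 (x ∷ y ∷ z ∷ xs)
    pick true  true  _     xy xz _  = apex-x (x≢y , xy) (x≢z , xz)
    pick false false _     xy xz _  = apex-x (x≢y , xy) (x≢z , xz)
    pick true  false true  xy _  yz = apex-y (x≢y , xy) (y≢z , yz)
    pick false true  false xy _  yz = apex-y (x≢y , xy) (y≢z , yz)
    pick true  false false _  xz yz = apex-z (x≢z , xz) (y≢z , yz)
    pick false true  true  _  xz yz = apex-z (x≢z , xz) (y≢z , yz)

  -- Setting `y` aside leaves at least five vertices, of which `y` treats three alike. The
  -- construction order is these three, then `y`, then `x`.
  large-neighbourhood : ∀ {x ys} → All (Joined b x) ys → Unique ys → 6 ≤ length ys →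
                        ContainsThreshold 5 G
  large-neighbourhood {ys = y ∷ ys} (xy ∷ xys) (y≢ys ∷ ys!) (s≤s 5≤)
    with c , 2< ← majority 2 (adj G y) ys 5≤ =
    ThresholdIn⇒ContainsThreshold (extend (xy ∷ All.filter⁺ c? xys)
      (extend (All.zip (All.filter⁺ c? y≢ys , All.all-filter c? ys))
        (triple (Unique.filter⁺ c? ys!) 2<)))
    where
    c? : ∀ z → Dec (adj G y z ≡ c)
    c? z = adj G y z ≟ c

  -- Here `x` separates `y` from `zs`, so `y` must come last: first three vertices of `zs`, then
  -- `x`, then `y`.
  split-neighbourhood : ∀ {x y zs} → b ≢ c → Joined b x y → All (Joined c x) zs →
    All (λ z → adj G y z ≡ b) zs → Unique zs → 3 ≤ length zs → ContainsThreshold 5 G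
  split-neighbourhood b≢c xy xzs yzs zs! 3≤ =
    ThresholdIn⇒ContainsThreshold (extend (Joined-sym xy ∷ All.zipWith join (xzs , yzs))
      (extend xzs (triple zs! 3≤)))
    where
    join : ∀ {z} → Joined _ _ z × adj G _ z ≡ _ → Joined _ _ z
    -- If `z` were `y`, the adjacency of `x` and `y` would be both `b` and `c`.
    join ((_ , xz) , yz) = (λ { refl → b≢c (trans (≡-sym (proj₂ xy)) xz) }) , yz

-- Ten vertices suffice

contains : (G : Graph 10) → ContainsThreshold 5 G
-- The other nine vertices exceed `4 + 4`, so some adjacency value `b` to `zero` occurs at least
-- five times. Keeping `b` arbitrary replaces passing to the complement.
contains G with b , 5≤N ← majority 4 (adj G zero) (tabulate suc) ℕ.≤-refl = search (6 ≤? length N)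
  where
  V N M : List (Fin 10)
  V = tabulate suc
  N = matching (adj G zero) b V
  M = matching (adj G zero) (not b) V

  V! : Unique V
  V! = Unique.tabulate⁺ suc-injective

  joined : ∀ c → All (Joined G c zero) (matching (adj G zero) c V)
  joined c = All.zip (All.filter⁺ c? (All.tabulate⁺ {f = suc} (λ _ → 0≢1+n)) , All.all-filter c? V)
    where
    c? : ∀ z → Dec (adj G zero z ≡ c)
    c? z = adj G zero z ≟ c

  matching! : ∀ (f : Fin 10 → Bool) c {xs} → Unique xs → Unique (matching f c xs)
  matching! f c = Unique.filter⁺ (λ z → f z ≟ c)

  search : Dec (6 ≤ length N) → ContainsThreshold 5 G
  search (yes 6≤N) = large-neighbourhood G (joined b) (matching! (adj G zero) b V!) 6≤N
  search (no  6≰N) with heavy-row-or-column 2 2 (adj G) b N M 18<20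
    where
    |N|≡5 : length N ≡ 5
    |N|≡5 = ≤-antisym (s≤s⁻¹ (≰⇒> 6≰N)) 5≤N

    |M|≡4 : length M ≡ 4
    |M|≡4 = +-cancelˡ-≡ 5 _ _ (trans (cong (_+ length M) (≡-sym |N|≡5)) (length-matching (adj G zero) b V))

    18<20 : length N * 2 + length M * 2 < length N * length M
    18<20 rewrite |N|≡5 | |M|≡4 = toWitness {a? = 18 <? 20} _
  ... | inj₁ row with a , a∈N , 2< ← find row =
    split-neighbourhood G (not-¬ refl) (All.lookup (joined b) a∈N)
      (All.filter⁺ b? (joined (not b))) (All.all-filter b? M)
      (matching! (adj G a) b (matching! (adj G zero) (not b) V!)) 2<
    where
    b? : ∀ z → Dec (adj G a z ≡ b)
    b? z = adj G a z ≟ b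
  -- The mirror case, with `b` and `not b` exchanged. A column fixes the second argument of `adj`,
  -- so symmetry turns its entries around.
  ... | inj₂ column with y , y∈M , 2< ← find column =
    split-neighbourhood G (≢-sym (not-¬ refl)) (All.lookup (joined (not b)) y∈M)
      (All.filter⁺ c? (joined b))
      (All.map (λ {z} → trans (sym G y z)) (All.all-filter c? N))
      (matching! (λ z → adj G z y) (not b) (matching! (adj G zero) b V!)) 2<
    where
    c? : ∀ z → Dec (adj G z y ≡ not b)
    c? z = adj G z y ≟ not b

-- Nine vertices do not

-- The vertices are the cells of the board numbered row by row. The `xor` demands exactly one common
-- coordinate, which excludes loops.
rook : Graph 9
rook .adj u v =
  does (quotient {3} 3 u Fin.≟ quotient 3 v) xor does (remainder {3} 3 u Fin.≟ remainder {3} 3 v)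
rook .sym = toWitness {a? = all? λ u → all? λ v → adj rook u v ≟ adj rook v u} _
rook .irrefl = toWitness {a? = all? λ v → adj rook v v ≟ false} _

-- The vertices z₁, z₂, z₃ are introduced one at a time so that the exhaustive
-- search prunes early.
rook-no-threshold : ∀ x y → x ≢ y →
  let Candidate = λ c z → x ≢ z × y ≢ z × adj rook x z ≡ adj rook x y × adj rook y z ≡ c in
  ∀ z₁ → Candidate (adj rook y z₁) z₁ →
  ∀ z₂ → z₁ ≢ z₂ × Candidate (adj rook y z₁) z₂ →
  ∀ z₃ → z₁ ≢ z₃ × z₂ ≢ z₃ → ¬ Candidate (adj rook y z₁) z₃
rook-no-threshold = toWitness
  {a? = all? λ x → all? λ y → x ≢? y →-dec
    (let candidate? = λ c z → x ≢? z ×-dec y ≢? z ×-dec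
           adj rook x z ≟ adj rook x y ×-dec adj rook y z ≟ c in
    all? λ z₁ → candidate? (adj rook y z₁) z₁ →-dec
    all? λ z₂ → (z₁ ≢? z₂ ×-dec candidate? (adj rook y z₁) z₂) →-dec
    all? λ z₃ → (z₁ ≢? z₃ ×-dec z₂ ≢? z₃) →-dec ¬? (candidate? (adj rook y z₁) z₃))} _
  where
  _≢?_ : (u v : Fin 9) → Dec (u ≢ v)
  u ≢? v = ¬? (u Fin.≟ v)

rook-¬contains : ¬ ContainsThreshold 5 rook
rook-¬contains (T , (T′ , T′-constructed , T′≅T) , T⊑rook) =
  no-embedding T′-constructed (⊑-trans T′ T rook (≅⇒⊑ T′ T T′≅T) T⊑rook)
  where
  no-embedding : ∀ {T} → Constructed T → ¬ T ⊑ rook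
  -- The vertices `0F` and `1F` were added last: `0F` treats all the others alike, and `1F` treats
  -- `2F`, `3F` and `4F` alike.
  no-embedding (add b (add c _)) (f , f-adj) =
    rook-no-threshold (to 0F) (to 1F) (distinct λ ())
      (to 2F) (candidate 2F (λ ()) (λ ()) refl refl)
      (to 3F) (distinct (λ ()) , candidate 3F (λ ()) (λ ()) refl refl)
      (to 4F) (distinct (λ ()) , distinct (λ ())) (candidate 4F (λ ()) (λ ()) refl refl)
    where
    open Injection f using (to; injective)

    distinct : ∀ {u v} → u ≢ v → to u ≢ to v
    distinct u≢v = u≢v ∘ injective

    -- The values `b` and `c` are read off at the images of `1F` and `2F`, which keeps the
    -- exhaustive search over vertices alone.
    candidate : ∀ u → 0F ≢ u → 1F ≢ u → _ → _ →
      to 0F ≢ to u × to 1F ≢ to u ×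
      adj rook (to 0F) (to u) ≡ adj rook (to 0F) (to 1F) ×
      adj rook (to 1F) (to u) ≡ adj rook (to 1F) (to 2F)
    candidate u 0≢u 1≢u 0u 1u = distinct 0≢u , distinct 1≢u ,
      trans (f-adj 0F u) (trans 0u (≡-sym (f-adj 0F 1F))) ,
      trans (f-adj 1F u) (trans 1u (≡-sym (f-adj 1F 2F)))

theorem3p15 : r′₂[ 5 ]≡ 10
theorem3p15 = contains , λ m m-suffices → ≮⇒≥ λ { (s≤s m≤9) →
  -- If some `m` below 10 sufficed, the subgraph of `rook` on its first `m` vertices would contain a
  -- threshold graph of order 5, and hence so would `rook`.
  let embedding = mk↣ (inject≤-injective m≤9 m≤9 _ _)
      H = induced (Injection.to embedding) rook
      T , T-threshold , T⊑H = m-suffices H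
  in rook-¬contains (T , T-threshold , ⊑-trans T H rook T⊑H (induced-⊑ embedding rook)) }
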